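{- Let $U$ be a countably infinite universe, $\mathcal{C}=(L_1,L_2,\ldots)$ a countably infinite collection of languages over $U$, $\mathcal{A}=\{A_g\}_{g\in[K]}$ a partition of $U$ into finitely many groups, $\alpha\in[0,1]$, and let $m^\star_\alpha(L_j)$ be computed by the Representative Procedure in the context. Suppose that for every $t\in\mathbb{N}$ the set $\{j: m^\star_\alpha(L_j)+1\le t\}$ is finite. Then there exists an algorithm that generates non-uniformly with $\alpha$-representation from $\mathcal{C}$ with generation times forming a Pareto-optimal sequence.
   Context: A language is an infinite subset of $U$; a collection is a sequence of languages (repetitions allowed, entries distinguished by index). An enumeration of $L$ is a sequence $x_1,x_2,\ldots$ with every $x_t\in L$ and every $x\in L$ equal to some $x_t$. $S_t$ is the set of distinct strings among $x_1,\ldots,x_t$. A generating algorithm outputs at each time $t$ a probability distribution $\mathcal{G}_t$ on $U$. For finite nonempty $T\subseteq U$, $\mathrm{emp}_T$ is uniform on $T$; $\mathrm{emp}_t=\mathrm{emp}_{S_t}$. For a distribution $D$, $D^{\mathcal{A}}(g)=\Pr_{x\sim D}[x\in A_g]$. The generator is $\alpha$-representative at $t$ if $\max_g|\mathrm{emp}_t^{\mathcal{A}}(g)-\mathcal{G}_t^{\mathcal{A}}(g)|\le\alpha$. An algorithm generates non-uniformly with $\alpha$-representation from $\mathcal{C}$ with (finite) generation times $t_\alpha(L_i)$ if for every $i$ and every enumeration of $L_i$, $\Pr_{x\sim\mathcal{G}_t}[x\in L_i\setminus S_t]=1$ whenever $|S_t|\ge t_\alpha(L_i)$, and it is $\alpha$-representative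 at every $t\ge1$. For an algorithm $\mathcal{G}$, $t_{\alpha,\mathcal{G}}(L_i)$ is the least such value ($\infty$ if none). A sequence $t(L_1),t(L_2),\ldots$ is Pareto-optimal if every algorithm $\mathcal{G}$ that generates non-uniformly with $\alpha$-representation from $\mathcal{C}$ and has $t_{\alpha,\mathcal{G}}(L_i)<t(L_i)$ for some $i$ also has $t_{\alpha,\mathcal{G}}(L_j)>t(L_j)$ for some other $j$. Scarce groups: for a collection $\mathcal{D}$ and finite $T$, $B=\{g: A_g\cap((\bigcap_{L\in\mathcal{D}}L)\setminus T)=\emptyset\}$; $T$ suffers group scarcity w.r.t. $\mathcal{D}$ and $\mathcal{A}$ if some $g\in B$ has $\mathrm{emp}_T^{\mathcal{A}}(g)>\alpha$ or $\sum_{g\in B}\mathrm{emp}_T^{\mathcal{A}}(g)>\alpha(K-|B|)$. Representative Procedure. Set $\mathcal{C}'_0=()$. For $i=1,2,\ldots$: append $L_i$ to $\mathcal{C}'_{i-1}$ to get $\mathcal{C}'_i=(L'_1,\ldots,L'_i)$, set $j=i$. Repeat: (i) let $m_{\mathrm{chk}}$ be the largest size of a finite (nonempty) set $T$ for which there is a subcollection $\mathcal{D}$ of the entries $(L'_1,\ldots,L'_j)$ including $L'_j$ with $T\subseteq L$ for all $L\in\mathcal{D}$ and $T$ suffering group scarcity w.r.t. $\mathcal{D}$ and $\mathcal{A}$ ($0$ if none). (ii) If $j\le1$ or $m_{\mathrm{chk}}>m^\star_\alpha(L'_{j-1})$, stop. (iii) Otherwise swap positions $j-1,j$, $j\leftarrow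 j-1$, return to (i). On stopping, $m^\star_\alpha(L_i)=m_{\mathrm{chk}}$. -}

module Defs where

open import Algebra.Bundles using (CommutativeRing)
import Algebra.Definitions.RawMonoid as RawMonoidDefs
import Algebra.Properties.Ring as RingProperties
open import Data.Bool.Base using (if_then_else_)
open import Data.Empty using (⊥-elim)
open import Data.Fin.Base using (Fin)
open import Data.Fin.Subset using (Subset; ∣_∣) renaming (_∈_ to _∈ˢ_)
open import Data.List.Base using (List; []; _∷_; _++_; length; map; foldr; applyUpTo; deduplicate)
open import Data.List.Membership.Propositional using (_∈_; _∉_)
open import Data.List.Membership.Propositional.Properties using (∈-∃++; ∈-++⁻; ∈-++⁺ˡ; ∈-++⁺ʳ)
import Data.List.Membership.DecPropositional as DecMembership
open import Data.List.NonEmpty.Base using (List⁺; _∷_; toList)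
open import Data.List.Properties using (length-++)
open import Data.List.Relation.Binary.Sublist.Propositional using (_⊆_)
open import Data.List.Relation.Unary.All using (All; []; _∷_)
import Data.List.Relation.Unary.All as All
open import Data.List.Relation.Unary.Any using (here; there)
open import Data.List.Relation.Unary.Unique.Propositional using (Unique; []; _∷_)
import Data.List.Relation.Unary.Unique.DecPropositional.Properties as UniqueDec
open import Data.Nat.Base as ℕ using (ℕ; zero; suc; _∸_; z≤n; s≤s)
import Data.Nat.Properties as ℕ
open import Data.Product.Base using (∃; _×_; _,_; proj₁; proj₂)
open import Data.Sum.Base using (_⊎_; inj₁; inj₂; [_,_]′)
open import Data.Unit.Base using (⊤)
import Data.Vec.Base as Vec
open import Function.Base using (_∘_)
open import Function.Bundles using (_↔_; _⇔_)
open import Function.Properties.Inverse using (↔⇒↣)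
open import Level using (0ℓ)
open import Relation.Binary.Definitions using (DecidableEquality)
open import Relation.Binary.PropositionalEquality as ≡ using (_≡_; _≢_)
open import Relation.Binary.Structures using (IsTotalOrder)
open import Relation.Nullary.Decidable using (Dec; yes; no; does; via-injection)
open import Relation.Nullary.Negation using (¬_)
open import Relation.Unary using (Pred; Satisfiable)

-- Classically a Dedekind-complete ordered field is unique up to
-- isomorphism, so an arbitrary one plays the role of ℝ.  Equality is a
-- setoid equality, since there are no quotient types in which a
-- model could be given with propositional equality.
record CompleteOrderedField : Set₁ where
  field
    commutativeRing : CommutativeRing 0ℓ 0ℓ

  open CommutativeRing commutativeRing public
    using ( Carrier; _≈_; _+_; _*_; -_; _-_; 0#; 1#; ring; setoid
          ; refl; sym; trans; reflexive
          ; +-cong; +-congˡ; +-congʳ; +-assoc; +-comm; +-identityˡ; +-identityʳ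
          ; -‿inverseˡ; -‿inverseʳ; -‿cong
          ; *-cong; *-congˡ; *-congʳ; *-assoc; *-comm; *-identityˡ; *-identityʳ
          ; distribˡ; distribʳ; zeroˡ; zeroʳ; +-rawMonoid )

  infix 4 _≤_ _<_

  field
    _≤_          : Carrier → Carrier → Set
    isTotalOrder : IsTotalOrder _≈_ _≤_
    0≉1          : ¬ (0# ≈ 1#)
    inverse      : ∀ x → ¬ (x ≈ 0#) → ∃ λ y → x * y ≈ 1#
    +-monoˡ-≤    : ∀ z {x y} → x ≤ y → x + z ≤ y + z
    *-nonneg     : ∀ {x y} → 0# ≤ x → 0# ≤ y → 0# ≤ x * y

  open IsTotalOrder isTotalOrder public
    using (total; antisym; ≤-resp-≈)
    renaming (refl to ≤-refl; reflexive to ≤-reflexive; trans to ≤-trans)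

  _<_ : Carrier → Carrier → Set
  x < y = x ≤ y × ¬ (x ≈ y)

  UpperBound : Pred Carrier 0ℓ → Pred Carrier 0ℓ
  UpperBound P u = ∀ x → P x → x ≤ u

  IsSupremum : Pred Carrier 0ℓ → Pred Carrier 0ℓ
  IsSupremum P s = UpperBound P s × (∀ u → UpperBound P u → s ≤ u)

  field
    complete : (P : Pred Carrier 0ℓ) → ∃ P → ∃ (UpperBound P) → ∃ (IsSupremum P)

  abs : Carrier → Carrier
  abs x = [ (λ _ → x) , (λ _ → - x) ]′ (total 0# x)

  open RawMonoidDefs +-rawMonoid public using (sum) renaming (_×_ to _·_)

  fromℕ : ℕ → Carrier
  fromℕ n = n · 1#

  sumOver : ∀ {K} → Subset K → (Fin K → Carrier) → Carrier
  sumOver B f = sum (λ g → if Vec.lookup B g then f g else 0#)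

module FieldLemmas (R : CompleteOrderedField) where
  open CompleteOrderedField R
  open RingProperties ring using (-‿involutive; -1*x≈-x; -‿distribʳ-*)

  x≤0⇒0≤-x : ∀ {x} → x ≤ 0# → 0# ≤ - x
  x≤0⇒0≤-x {x} p =
    ≤-trans (≤-reflexive (sym (-‿inverseʳ x)))
      (≤-trans (+-monoˡ-≤ (- x) p) (≤-reflexive (+-identityˡ (- x))))

  0≤1 : 0# ≤ 1#
  0≤1 = [ (λ p → p)
        , (λ p → ≤-trans (*-nonneg (x≤0⇒0≤-x p) (x≤0⇒0≤-x p))
                         (≤-reflexive (trans (-1*x≈-x (- 1#)) (-‿involutive 1#)))) ]′
        (total 0# 1#)

  1≰0 : ¬ (1# ≤ 0#)
  1≰0 p = 0≉1 (antisym 0≤1 p)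

  +-mono-≤ : ∀ {a b c d} → a ≤ b → c ≤ d → a + c ≤ b + d
  +-mono-≤ {a} {b} {c} {d} p q =
    ≤-trans (+-monoˡ-≤ c p)
      (≤-trans (≤-reflexive (+-comm b c))
        (≤-trans (+-monoˡ-≤ b q) (≤-reflexive (+-comm d b))))

  ·-nonneg : ∀ n {x} → 0# ≤ x → 0# ≤ n · x
  ·-nonneg zero    p = ≤-refl
  ·-nonneg (suc n) p =
    ≤-trans (≤-reflexive (sym (+-identityˡ 0#))) (+-mono-≤ p (·-nonneg n p))

  ·-monoˡ-≤ : ∀ {m n x} → 0# ≤ x → m ℕ.≤ n → m · x ≤ n · x
  ·-monoˡ-≤ {n = n} p z≤n = ·-nonneg n p
  ·-monoˡ-≤ p (s≤s q) = +-mono-≤ ≤-refl (·-monoˡ-≤ p q)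

  fromℕ-* : ∀ n x → fromℕ n * x ≈ n · x
  fromℕ-* zero    x = zeroˡ x
  fromℕ-* (suc n) x = trans (distribʳ x 1# (fromℕ n)) (+-cong (*-identityˡ x) (fromℕ-* n x))

  fromℕ-suc≉0 : ∀ n → ¬ (fromℕ (suc n) ≈ 0#)
  fromℕ-suc≉0 n p = 1≰0
    (≤-trans (≤-reflexive (sym (+-identityʳ 1#)))
      (≤-trans (+-mono-≤ ≤-refl (·-nonneg n 0≤1)) (≤-reflexive p)))

  inverse-nonneg : ∀ {x y} → 0# ≤ x → x * y ≈ 1# → 0# ≤ y
  inverse-nonneg {x} {y} 0≤x xy≈1 with total 0# y
  ... | inj₁ 0≤y = 0≤y
  ... | inj₂ y≤0 = ⊥-elim (1≰0 1≤0)
    where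
    0≤-1 : 0# ≤ - 1#
    0≤-1 = ≤-trans (*-nonneg 0≤x (x≤0⇒0≤-x y≤0))
             (≤-reflexive (trans (sym (-‿distribʳ-* x y)) (-‿cong xy≈1)))
    1≤0 : 1# ≤ 0#
    1≤0 = ≤-trans (≤-reflexive (sym (+-identityˡ 1#)))
            (≤-trans (+-monoˡ-≤ 1# 0≤-1) (≤-reflexive (-‿inverseˡ 1#)))

Finite : {X : Set} → Pred X 0ℓ → Set
Finite P = ∃ λ xs → ∀ x → P x → x ∈ xs

record Language (U : Set) : Set₁ where
  field
    _∋_      : Pred U 0ℓ
    infinite : ¬ Finite _∋_

open Language public using (_∋_)

record Partition (U : Set) (K : ℕ) : Set₁ where
  field
    block    : Fin K → Pred U 0ℓ
    nonEmpty : ∀ g → Satisfiable (block g)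
    covers   : ∀ x → ∃ λ g → block g x
    disjoint : ∀ {g h x} → block g x → block h x → g ≡ h

record FiniteNonEmptySet (U : Set) : Set where
  field
    elements : List U
    unique   : Unique elements
    nonEmpty : elements ≢ []

  size : ℕ
  size = length elements

open FiniteNonEmptySet public using (elements; size)

record Enumerates {U : Set} (x : ℕ → U) (L : Language U) : Set where
  field
    sound    : ∀ t → L ∋ x t
    complete : ∀ y → L ∋ y → ∃ λ t → x t ≡ y

-- With times starting at 1 and x indexed from 0, this is the input seen at time t + 1.
history : {U : Set} → (ℕ → U) → ℕ → List⁺ U
history x t = x 0 ∷ applyUpTo (x ∘ suc) t

module _ {A : Set} where

  private
    remove : ∀ {x y : A} ys {zs} → y ∈ ys ++ x ∷ zs → x ≢ y → y ∈ ys ++ zs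
    remove ys p x≢y with ∈-++⁻ ys p
    ... | inj₁ q         = ∈-++⁺ˡ q
    ... | inj₂ (here q)  = ⊥-elim (x≢y (≡.sym q))
    ... | inj₂ (there q) = ∈-++⁺ʳ ys q

  unique-length : ∀ {xs ys : List A} → Unique xs → (∀ {x} → x ∈ xs → x ∈ ys) →
                  length xs ℕ.≤ length ys
  unique-length [] _ = z≤n
  unique-length {x ∷ xs} (x∉xs ∷ u) sub with ∈-∃++ (sub (here ≡.refl))
  ... | as , bs , ≡.refl =
    ≡.subst (suc (length xs) ℕ.≤_) (≡.sym len)
      (s≤s (unique-length u λ y∈xs → remove as (sub (there y∈xs)) (All.lookup x∉xs y∈xs)))
    where
    len : length (as ++ x ∷ bs) ≡ suc (length (as ++ bs))
    len = ≡.trans (length-++ as)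
            (≡.trans (ℕ.+-suc (length as) (length bs))
                     (≡.cong suc (≡.sym (length-++ as))))

module Probability (R : CompleteOrderedField) {U : Set} (U↔ℕ : U ↔ ℕ) where
  open CompleteOrderedField R
  open FieldLemmas R

  _≟_ : DecidableEquality U
  _≟_ = via-injection (↔⇒↣ U↔ℕ) ℕ._≟_

  open DecMembership _≟_ using (_∈?_)

  sumList : (U → Carrier) → List U → Carrier
  sumList f xs = foldr _+_ 0# (map f xs)

  -- For nonnegative f, the supremum of PartialSum f E is Σ_{x ∈ E} f x.
  PartialSum : (U → Carrier) → Pred U 0ℓ → Pred Carrier 0ℓ
  PartialSum f E s = ∃ λ xs → Unique xs × All E xs × sumList f xs ≈ s

  record Distribution : Set where
    field
      mass      : U → Carrier
      nonneg    : ∀ x → 0# ≤ mass x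
      totalMass : IsSupremum (PartialSum mass (λ _ → ⊤)) 1#

  open Distribution

  Pr : Distribution → Pred U 0ℓ → Carrier
  Pr D E = proj₁ (complete (PartialSum (mass D) E) nonEmptySums boundedSums)
    where
    nonEmptySums : ∃ (PartialSum (mass D) E)
    nonEmptySums = 0# , [] , [] , [] , refl
    boundedSums : ∃ (UpperBound (PartialSum (mass D) E))
    boundedSums = 1# , λ { s (xs , u , _ , e) →
      proj₁ (totalMass D) s (xs , u , All.universal (λ _ → _) xs , e) }

  module _ (T : FiniteNonEmptySet U) where

    size≉0 : ¬ (fromℕ (size T) ≈ 0#)
    size≉0 with elements T | FiniteNonEmptySet.nonEmpty T
    ... | []     | ne = ⊥-elim (ne ≡.refl)
    ... | _ ∷ xs | _  = fromℕ-suc≉0 (length xs)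

    weight : Carrier
    weight = proj₁ (inverse (fromℕ (size T)) size≉0)

    weight-nonneg : 0# ≤ weight
    weight-nonneg = inverse-nonneg (·-nonneg (size T) 0≤1)
                      (proj₂ (inverse (fromℕ (size T)) size≉0))

    size·weight : size T · weight ≈ 1#
    size·weight = trans (sym (fromℕ-* (size T) weight))
                        (proj₂ (inverse (fromℕ (size T)) size≉0))

    uniformMass : U → Carrier
    uniformMass x = if does (x ∈? elements T) then weight else 0#

    support : List U → List U
    support []       = []
    support (x ∷ xs) with x ∈? elements T
    ... | yes _ = x ∷ support xs
    ... | no  _ = support xs

    support-sub : ∀ xs {y} → y ∈ support xs → y ∈ xs × y ∈ elements T
    support-sub (x ∷ xs) p with x ∈? elements T
    support-sub (x ∷ xs) (here ≡.refl) | yes q = here ≡.refl , q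
    support-sub (x ∷ xs) (there p)     | yes _ =
      there (proj₁ (support-sub xs p)) , proj₂ (support-sub xs p)
    support-sub (x ∷ xs) p             | no _  =
      there (proj₁ (support-sub xs p)) , proj₂ (support-sub xs p)

    support-unique : ∀ {xs} → Unique xs → Unique (support xs)
    support-unique [] = []
    support-unique {x ∷ xs} (x∉xs ∷ u) with x ∈? elements T
    ... | yes _ = All.tabulate (λ p → All.lookup x∉xs (proj₁ (support-sub xs p)))
                  ∷ support-unique u
    ... | no  _ = support-unique u

    sum-support : ∀ xs → sumList uniformMass xs ≈ length (support xs) · weight
    sum-support [] = refl
    sum-support (x ∷ xs) with x ∈? elements T
    ... | yes _ = +-congˡ (sum-support xs)
    ... | no  _ = trans (+-identityˡ _) (sum-support xs)

    sum-inside : ∀ {xs} → All (_∈ elements T) xs → sumList uniformMass xs ≈ length xs · weight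
    sum-inside [] = refl
    sum-inside {x ∷ xs} (p ∷ ps) with x ∈? elements T
    ... | yes _ = +-congˡ (sum-inside ps)
    ... | no ¬p = ⊥-elim (¬p p)

    uniform-nonneg : ∀ x → 0# ≤ uniformMass x
    uniform-nonneg x with x ∈? elements T
    ... | yes _ = weight-nonneg
    ... | no  _ = ≤-refl

    emp : Distribution
    emp .mass   = uniformMass
    emp .nonneg = uniform-nonneg
    emp .totalMass = upper , least
      where
      upper : UpperBound (PartialSum uniformMass (λ _ → ⊤)) 1#
      upper s (xs , u , _ , e) =
        ≤-trans (≤-reflexive (trans (sym e) (sum-support xs)))
          (≤-trans (·-monoˡ-≤ weight-nonneg
                     (unique-length (support-unique u) (λ p → proj₂ (support-sub xs p))))
                   (≤-reflexive size·weight))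
      least : ∀ v → UpperBound (PartialSum uniformMass (λ _ → ⊤)) v → 1# ≤ v
      least v ub = ub 1# ( elements T , FiniteNonEmptySet.unique T
                         , All.universal (λ _ → _) (elements T)
                         , trans (sum-inside (All.tabulate (λ p → p))) size·weight )

  seen : List⁺ U → FiniteNonEmptySet U
  seen h .elements = deduplicate _≟_ (toList h)
  seen h .FiniteNonEmptySet.unique = UniqueDec.deduplicate-! _≟_ (toList h)
  seen (_ ∷ _) .FiniteNonEmptySet.nonEmpty ()

  Algorithm : Set
  Algorithm = List⁺ U → Distribution

module RepresentativeGeneration
  (R : CompleteOrderedField) {U : Set} (U↔ℕ : U ↔ ℕ)
  (C : ℕ → Language U) {K : ℕ} (A : Partition U K)
  (α : CompleteOrderedField.Carrier R) where

  open CompleteOrderedField R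
  open Probability R U↔ℕ public
  open Partition A using (block)

  -- D^𝒜(g)
  groupProb : Distribution → Fin K → Carrier
  groupProb D g = Pr D (block g)

  RepresentativeAt : Algorithm → List⁺ U → Set
  RepresentativeAt G h =
    ∀ g → abs (groupProb (emp (seen h)) g - groupProb (G h) g) ≤ α

  GeneratesFreshAt : Algorithm → ℕ → List⁺ U → Set
  GeneratesFreshAt G i h = Pr (G h) (λ y → (C i ∋ y) × y ∉ elements (seen h)) ≈ 1#

  -- Generation times are positive integers: |S_t| ≥ 1 at every time t ≥ 1,
  -- so the conditions for the values 0 and 1 would coincide.
  GenerationTime : Algorithm → ℕ → ℕ → Set
  GenerationTime G i n = 1 ℕ.≤ n ×
    (∀ x → Enumerates x (C i) → ∀ t → n ℕ.≤ size (seen (history x t)) →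
       GeneratesFreshAt G i (history x t))

  LeastGenerationTime : Algorithm → ℕ → ℕ → Set
  LeastGenerationTime G i n =
    GenerationTime G i n × (∀ k → GenerationTime G i k → n ℕ.≤ k)

  GeneratesWithTimes : Algorithm → (ℕ → ℕ) → Set
  GeneratesWithTimes G τ =
    (∀ i → GenerationTime G i (τ i)) ×
    (∀ i x → Enumerates x (C i) → ∀ t → RepresentativeAt G (history x t))

  Generates : Algorithm → Set
  Generates G = ∃ λ τ → GeneratesWithTimes G τ

  -- A generating G has finite least generation times, so the value ∞ needs no encoding here.
  ParetoOptimal : (ℕ → ℕ) → Set
  ParetoOptimal τ = ∀ G → Generates G →
    ∀ i → (∃ λ n → LeastGenerationTime G i n × n ℕ.< τ i) →
    ∃ λ j → j ≢ i × (∃ λ n → LeastGenerationTime G j n × τ j ℕ.< n)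

  -- Subcollections are lists of indices into C.

  InAll : List ℕ → Pred U 0ℓ
  InAll 𝒟 x = All (λ k → C k ∋ x) 𝒟

  Exhausted : List ℕ → FiniteNonEmptySet U → Fin K → Set
  Exhausted 𝒟 T g = ∀ x → block g x → ¬ (InAll 𝒟 x × x ∉ elements T)

  GroupScarcity : List ℕ → FiniteNonEmptySet U → Set
  GroupScarcity 𝒟 T = ∃ λ (B : Subset K) →
    (∀ g → g ∈ˢ B ⇔ Exhausted 𝒟 T g) ×
    ( (∃ λ g → g ∈ˢ B × α < groupProb (emp T) g)
    ⊎ (α * fromℕ (K ∸ ∣ B ∣) < sumOver B (groupProb (emp T))) )

  -- Orderings are stored last entry first: for an entry i preceded by
  -- (L′₁, …, L′ⱼ₋₁), ρ = L′ⱼ₋₁ ∷ … ∷ L′₁ ∷ [].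

  ScarceSize : List ℕ → ℕ → ℕ → Set
  ScarceSize ρ i n = ∃ λ (T : FiniteNonEmptySet U) → size T ≡ n ×
    (∃ λ 𝒟 → 𝒟 ⊆ (i ∷ ρ) × i ∈ 𝒟 × All (InAll 𝒟) (elements T) × GroupScarcity 𝒟 T)

  CheckValue : List ℕ → ℕ → ℕ → Set
  CheckValue ρ i m =
      (ScarceSize ρ i m × (∀ n → ScarceSize ρ i n → n ℕ.≤ m))
    ⊎ ((∀ n → ¬ ScarceSize ρ i n) × m ≡ 0)

  -- Insert m i ρ ρ′: the inner loop for L_i, started behind the entries of ρ,
  -- stops with the ordering ρ′ and the value m i.
  data Insert (m : ℕ → ℕ) (i : ℕ) : List ℕ → List ℕ → Set where
    stop-first : CheckValue [] i (m i) → Insert m i [] (i ∷ [])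
    stop       : ∀ {k ρ} → CheckValue (k ∷ ρ) i (m i) → m k ℕ.< m i →
                 Insert m i (k ∷ ρ) (i ∷ k ∷ ρ)
    swap       : ∀ {k ρ ρ′ c} → CheckValue (k ∷ ρ) i c → c ℕ.≤ m k →
                 Insert m i ρ ρ′ → Insert m i (k ∷ ρ) (k ∷ ρ′)

  -- A run of the procedure with outputs m.  Outputs are natural numbers, so
  -- every maximum taken is attained; this is automatic unless α ≈ 0#.
  record RepresentativeProcedure (m : ℕ → ℕ) : Set where
    field
      ordering : ℕ → List ℕ
      initial  : ordering 0 ≡ []
      insert   : ∀ i → Insert m i (ordering i) (ordering (suc i))

{-# OPTIONS --safe #-}

-- A finite set T suffers group scarcity with respect to 𝒟 exactly when no
-- distribution concentrated on (⋂ 𝒟) ∖ T is α-representative for emp_T: an exhausted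
-- group loses all of its mass, at most α, and the lost mass has to go to the other
-- groups, each of which can take at most α more, so one may share it equally.
--
-- The procedure keeps the invariant that a scarce set for a subcollection 𝒟 has size
-- at most m⋆ of the entry of 𝒟 placed last, and that m⋆ is nondecreasing along the
-- ordering.  Hence, at the input set S, the languages L ⊇ S with m⋆(L) < |S| can be
-- served simultaneously, which achieves the times m⋆ + 1.  Conversely m⋆(Lᵢ) is the
-- size of a set T scarce for some 𝒟 ∋ Lᵢ whose other members have smaller m⋆; if Lᵢ
-- were served by time m⋆(Lᵢ) and the others by m⋆ + 1, then on input T all of 𝒟
-- would have to be served at once, against scarcity.
module Submission where

open import Defs
open import Algebra.Bundles using (CommutativeRing)
import Algebra.Properties.CommutativeSemigroup as CommutativeSemigroupProperties
import Algebra.Properties.Ring as RingProperties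
open import Axiom.ExcludedMiddle using (ExcludedMiddle)
open import Data.Bool.Base using (true; false; if_then_else_)
open import Data.Empty using (⊥; ⊥-elim)
open import Data.Fin.Base using (Fin; zero; suc)
open import Data.Fin.Properties using (suc-injective)
open import Data.Fin.Subset using (Subset; ∁; ∣_∣) renaming (_∈_ to _∈ˢ_)
open import Data.Fin.Subset.Properties using (∣∁p∣≡n∸∣p∣; _∈?_; x∈∁p⇒x∉p; x∉p⇒x∈∁p)
open import Data.List.Base using (List; []; _∷_; _++_; filter; length; applyUpTo)
import Data.List.Membership.DecPropositional as DecMembership
open import Data.List.Membership.Propositional using (_∈_; _∉_)
open import Data.List.Membership.Propositional.Properties
  using (∈-filter⁺; ∈-filter⁻; ∈-deduplicate⁺; ∈-deduplicate⁻)
open import Data.List.NonEmpty.Base using (List⁺; _∷_; toList; tail)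
open import Data.List.Relation.Binary.Sublist.Propositional using (lookup)
open import Data.List.Relation.Binary.Sublist.Propositional.Properties using (filter-⊆)
open import Data.List.Relation.Unary.All using (All; []; _∷_)
import Data.List.Relation.Unary.All as All
import Data.List.Relation.Unary.All.Properties as All
open import Data.List.Relation.Unary.AllPairs using (AllPairs; []; _∷_)
open import Data.List.Relation.Unary.Any using (here; there)
open import Data.List.Relation.Unary.Unique.Propositional using (Unique)
import Data.List.Relation.Unary.Unique.Propositional.Properties as Unique
open import Data.Nat.Base as ℕ using (ℕ; zero; suc; z≤n)
import Data.Nat.Properties as ℕ
open import Data.Product.Base using (∃; _×_; _,_; proj₁; proj₂)
open import Data.Sum.Base using (_⊎_; inj₁; inj₂; [_,_]′)
import Data.Vec.Base as Vec
open import Data.Vec.Properties using ([]=⇒lookup; lookup⇒[]=; lookup∘tabulate)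
open import Function.Base using (_∘_; id)
open import Function.Bundles using (_↔_; _⇔_; mk⇔; module Equivalence; module Inverse)
open import Level using (0ℓ)
open import Relation.Binary.PropositionalEquality as ≡ using (_≡_; _≢_)
open import Relation.Nullary.Decidable using (Dec; yes; no; does; dec-true; decidable-stable)
open import Relation.Nullary.Negation using (¬_; contradiction)
open import Relation.Unary using (Pred)

-- Inequalities, integer multiples and sums over sets of groups in the ordered field.

module OrderedFieldProperties (R : CompleteOrderedField) where
  open CompleteOrderedField R
  open FieldLemmas R
  open CommutativeRing commutativeRing using (+-commutativeSemigroup)
  open RingProperties ring using (⁻¹-anti-homo-//; //-rightDividesˡ; //-rightDividesʳ)
  open CommutativeSemigroupProperties +-commutativeSemigroup using (interchange)

  x+y≤z⇒x≤z-y : ∀ {x y z} → x + y ≤ z → x ≤ z - y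
  x+y≤z⇒x≤z-y {x} {y} p = ≤-trans (≤-reflexive (sym (//-rightDividesʳ y x))) (+-monoˡ-≤ (- y) p)

  x≤z-y⇒x+y≤z : ∀ {x y z} → x ≤ z - y → x + y ≤ z
  x≤z-y⇒x+y≤z {y = y} {z} p = ≤-trans (+-monoˡ-≤ y p) (≤-reflexive (//-rightDividesˡ y z))

  x≤z+y⇒x-y≤z : ∀ {x y z} → x ≤ z + y → x - y ≤ z
  x≤z+y⇒x-y≤z {y = y} {z} p = ≤-trans (+-monoˡ-≤ (- y) p) (≤-reflexive (//-rightDividesʳ y z))

  x-y≤z⇒x≤z+y : ∀ {x y z} → x - y ≤ z → x ≤ z + y
  x-y≤z⇒x≤z+y {x} {y} p = ≤-trans (≤-reflexive (sym (//-rightDividesˡ y x))) (+-monoˡ-≤ y p)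

  +-cancelʳ-≤ : ∀ z {x y} → x + z ≤ y + z → x ≤ y
  +-cancelʳ-≤ z {x} {y} p = ≤-trans (x+y≤z⇒x≤z-y p) (≤-reflexive (//-rightDividesʳ z y))

  +-cancelˡ-≤ : ∀ z {x y} → z + x ≤ z + y → x ≤ y
  +-cancelˡ-≤ z {x} {y} p = +-cancelʳ-≤ z
    (≤-trans (≤-reflexive (+-comm x z)) (≤-trans p (≤-reflexive (+-comm z y))))

  +-nonneg : ∀ {x y} → 0# ≤ x → 0# ≤ y → 0# ≤ x + y
  +-nonneg p q = ≤-trans (≤-reflexive (sym (+-identityˡ 0#))) (+-mono-≤ p q)

  x≤x+y : ∀ {x y} → 0# ≤ y → x ≤ x + y
  x≤x+y {x} p = ≤-trans (≤-reflexive (sym (+-identityʳ x))) (+-mono-≤ ≤-refl p)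

  ∣x-y∣≤z : ∀ {x y z} → x ≤ z + y → y ≤ z + x → abs (x - y) ≤ z
  ∣x-y∣≤z {x} {y} p q with total 0# (x - y)
  ... | inj₁ _ = x≤z+y⇒x-y≤z p
  ... | inj₂ _ = ≤-trans (≤-reflexive (⁻¹-anti-homo-// x y)) (x≤z+y⇒x-y≤z q)

  x≤abs : ∀ x → x ≤ abs x
  x≤abs x with total 0# x
  ... | inj₁ _   = ≤-refl
  ... | inj₂ x≤0 = ≤-trans x≤0 (x≤0⇒0≤-x x≤0)

  -x≤abs : ∀ x → - x ≤ abs x
  -x≤abs x with total 0# x
  ... | inj₁ 0≤x = ≤-trans (≤-trans (≤-reflexive (sym (+-identityˡ (- x))))
                     (x≤z+y⇒x-y≤z (≤-trans 0≤x (≤-reflexive (sym (+-identityˡ x)))))) 0≤x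
  ... | inj₂ _   = ≤-refl

  ∣x-y∣≤z⇒x≤z+y : ∀ {x y z} → abs (x - y) ≤ z → x ≤ z + y
  ∣x-y∣≤z⇒x≤z+y {x} {y} p = x-y≤z⇒x≤z+y (≤-trans (x≤abs (x - y)) p)

  ∣x-y∣≤z⇒y≤z+x : ∀ {x y z} → abs (x - y) ≤ z → y ≤ z + x
  ∣x-y∣≤z⇒y≤z+x {x} {y} p = x-y≤z⇒x≤z+y
    (≤-trans (≤-reflexive (sym (⁻¹-anti-homo-// x y))) (≤-trans (-x≤abs (x - y)) p))

  ·-monoʳ-≤ : ∀ n {x y} → x ≤ y → n · x ≤ n · y
  ·-monoʳ-≤ zero    p = ≤-refl
  ·-monoʳ-≤ (suc n) p = +-mono-≤ p (·-monoʳ-≤ n p)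

  ·-cancelˡ-≤ : ∀ n {x y} → suc n · x ≤ suc n · y → x ≤ y
  ·-cancelˡ-≤ n {x} {y} p with total x y
  ... | inj₁ x≤y = x≤y
  -- From `n · y ≤ n · x` and the hypothesis, `x + n · y ≤ y + n · y`, and `n · y` cancels.
  ... | inj₂ y≤x = +-cancelʳ-≤ (n · y) (≤-trans (+-mono-≤ ≤-refl (·-monoʳ-≤ n y≤x)) p)

  ·-divide : ∀ n x → ∃ λ y → suc n · y ≈ x
  ·-divide n x with inverse (fromℕ (suc n)) (fromℕ-suc≉0 n)
  ... | r , nr≈1 = r * x , trans (sym (fromℕ-* (suc n) (r * x)))
    (trans (sym (*-assoc _ r x)) (trans (*-congʳ nr≈1) (*-identityˡ x)))

  sumOver-+ : ∀ {n} (B : Subset n) f g →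
              sumOver B (λ i → f i + g i) ≈ sumOver B f + sumOver B g
  sumOver-+ Vec.[] f g = sym (+-identityˡ 0#)
  sumOver-+ (b Vec.∷ B) f g = trans (+-cong (split b) (sumOver-+ B (f ∘ suc) (g ∘ suc)))
    (interchange _ _ _ _)
    where
    split : ∀ b → (if b then f zero + g zero else 0#) ≈
                  (if b then f zero else 0#) + (if b then g zero else 0#)
    split true  = refl
    split false = sym (+-identityˡ 0#)

  sumOver-mono : ∀ {n} (B : Subset n) {f g} → (∀ i → i ∈ˢ B → f i ≤ g i) →
                 sumOver B f ≤ sumOver B g
  sumOver-mono Vec.[] p = ≤-refl
  sumOver-mono (true  Vec.∷ B) p =
    +-mono-≤ (p zero Vec.here) (sumOver-mono B (λ i i∈B → p (suc i) (Vec.there i∈B)))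
  sumOver-mono (false Vec.∷ B) p =
    +-mono-≤ ≤-refl (sumOver-mono B (λ i i∈B → p (suc i) (Vec.there i∈B)))

  sumOver-const : ∀ {n} (B : Subset n) c → sumOver B (λ _ → c) ≈ ∣ B ∣ · c
  sumOver-const Vec.[]          c = refl
  sumOver-const (true  Vec.∷ B) c = +-congˡ (sumOver-const B c)
  sumOver-const (false Vec.∷ B) c = trans (+-identityˡ _) (sumOver-const B c)

  sumOver-∁ : ∀ {n} (B : Subset n) f → sumOver B f + sumOver (∁ B) f ≈ sum f
  sumOver-∁ Vec.[] f = +-identityˡ 0#
  sumOver-∁ (true Vec.∷ B) f = trans (+-assoc _ _ _) (+-congˡ
    (trans (+-congˡ (+-identityˡ _)) (sumOver-∁ B (f ∘ suc))))
  sumOver-∁ (false Vec.∷ B) f = trans (+-congʳ (+-identityˡ _)) (trans (sym (+-assoc _ _ _))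
    (trans (+-congʳ (+-comm _ _)) (trans (+-assoc _ _ _) (+-congˡ (sumOver-∁ B (f ∘ suc))))))

-- Suprema in the complete ordered field.

module Suprema (em : ExcludedMiddle 0ℓ) (R : CompleteOrderedField) where
  open CompleteOrderedField R

  ¬<⇒≥ : ∀ {x y} → ¬ (x < y) → y ≤ x
  ¬<⇒≥ {x} {y} x≮y with total y x
  ... | inj₁ y≤x = y≤x
  ... | inj₂ x≤y with em {x ≈ y}
  ...   | yes x≈y = ≤-reflexive (sym x≈y)
  ...   | no  x≉y = ⊥-elim (x≮y (x≤y , x≉y))

  supremum-unique : ∀ {P s t} → IsSupremum P s → IsSupremum P t → s ≈ t
  supremum-unique (ub , least) (ub′ , least′) = antisym (least _ ub′) (least′ _ ub)

  supremum-resp : ∀ {P Q s t} → (∀ {x} → P x → Q x) → (∀ {x} → Q x → P x) → s ≈ t →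
                  IsSupremum P s → IsSupremum Q t
  supremum-resp P⊆Q Q⊆P s≈t (ub , least) =
    (λ x q → ≤-trans (ub x (Q⊆P q)) (≤-reflexive s≈t)) ,
    (λ u ub′ → ≤-trans (≤-reflexive (sym s≈t)) (least u (λ x p → ub′ x (P⊆Q p))))

-- Infinite sums as suprema of finite partial sums, and probabilities of events.

module Sums (em : ExcludedMiddle 0ℓ) (R : CompleteOrderedField)
            {U : Set} (U↔ℕ : U ↔ ℕ) where
  open CompleteOrderedField R
  open CommutativeRing commutativeRing using (+-commutativeSemigroup)
  open CommutativeSemigroupProperties +-commutativeSemigroup using (x∙yz≈y∙xz)
  open FieldLemmas R
  open OrderedFieldProperties R
  open Suprema em R
  open Probability R U↔ℕ
  open Distribution

  IsSum : (U → Carrier) → Pred U 0ℓ → Carrier → Set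
  IsSum f E = IsSupremum (PartialSum f E)

  sumList-filter : ∀ f {E E′ : Pred U 0ℓ} → (∀ {x} → E x → ¬ E′ x → f x ≈ 0#) →
                   ∀ {xs} → All E xs → sumList f xs ≈ sumList f (filter (λ x → em {E′ x}) xs)
  sumList-filter f null [] = refl
  sumList-filter f {E′ = E′} null {x ∷ xs} (p ∷ ps) with em {E′ x}
  ... | yes _  = +-congˡ (sumList-filter f null ps)
  ... | no ¬e′ = trans (+-cong (null p ¬e′) (sumList-filter f null ps)) (+-identityˡ _)

  PartialSum-mono : ∀ {f} {E E′ : Pred U 0ℓ} → (∀ {x} → E x → E′ x) →
                    ∀ {s} → PartialSum f E s → PartialSum f E′ s
  PartialSum-mono E⊆E′ (xs , u , ps , e) = xs , u , All.map E⊆E′ ps , e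

  module _ {f : U → Carrier} where

    IsSum-resp-⇔ : ∀ {E E′ : Pred U 0ℓ} {s t} → (∀ {x} → E x → E′ x) → (∀ {x} → E′ x → E x) →
                   s ≈ t → IsSum f E s → IsSum f E′ t
    IsSum-resp-⇔ E⊆E′ E′⊆E = supremum-resp (PartialSum-mono E⊆E′) (PartialSum-mono E′⊆E)

    module _ {E E′ : Pred U 0ℓ} (E′⊆E : ∀ {x} → E′ x → E x)
             (null : ∀ {x} → E x → ¬ E′ x → f x ≈ 0#) where

      private
        -- Deleting the null points from a finite list does not change its sum, so `E` and `E′` have
        -- the same partial sums and hence the same supremum.
        shrink : ∀ {s} → PartialSum f E s → PartialSum f E′ s
        shrink (xs , u , ps , e) =
          filter E′? xs , Unique.filter⁺ E′? u , All.all-filter E′? xs ,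
          trans (sym (sumList-filter f null ps)) e
          where
          E′? : ∀ x → Dec (E′ x)
          E′? x = em

      IsSum-extend : ∀ {s} → IsSum f E′ s → IsSum f E s
      IsSum-extend = supremum-resp (PartialSum-mono E′⊆E) shrink refl

      IsSum-restrict : ∀ {s} → IsSum f E s → IsSum f E′ s
      IsSum-restrict = supremum-resp shrink (PartialSum-mono E′⊆E) refl

    IsSum-∅ : ∀ {E : Pred U 0ℓ} → (∀ {x} → ¬ E x) → IsSum f E 0#
    IsSum-∅ empty = (λ { s ([] , _ , _ , e) → ≤-reflexive (sym e)
                       ; s (x ∷ xs , _ , p ∷ _ , _) → ⊥-elim (empty p) }) ,
                    (λ u ub → ub 0# ([] , [] , [] , refl))

    IsSum-singleton : ∀ {x} → 0# ≤ f x → IsSum f (_≡ x) (f x)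
    IsSum-singleton {x} 0≤fx =
      (λ { s ([] , _ , _ , e) → ≤-trans (≤-reflexive (sym e)) 0≤fx
         ; s (_ ∷ [] , _ , ≡.refl ∷ [] , e) → ≤-reflexive (trans (sym e) (+-identityʳ _))
         ; s (_ ∷ _ ∷ _ , (y≢z ∷ _) ∷ _ , p ∷ q ∷ _ , e) → ⊥-elim (y≢z (≡.trans p (≡.sym q))) }) ,
      (λ u ub → ub (f x) (x ∷ [] , [] ∷ [] , ≡.refl ∷ [] , +-identityʳ _))

    private
      sumList-++ : ∀ xs ys → sumList f (xs ++ ys) ≈ sumList f xs + sumList f ys
      sumList-++ []       ys = sym (+-identityˡ _)
      sumList-++ (x ∷ xs) ys = trans (+-congˡ (sumList-++ xs ys)) (sym (+-assoc _ _ _))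

      sumList-filter-⊎ : ∀ {E F : Pred U 0ℓ} → (∀ {x} → E x → ¬ F x) →
                         ∀ {xs} → All (λ x → E x ⊎ F x) xs →
                         sumList f xs ≈ sumList f (filter (λ x → em {E x}) xs) +
                                        sumList f (filter (λ x → em {F x}) xs)
      sumList-filter-⊎ disj [] = sym (+-identityˡ 0#)
      sumList-filter-⊎ {E} {F} disj {x ∷ xs} (p ∷ ps) with em {E x} | em {F x}
      ... | yes e | yes e′ = ⊥-elim (disj e e′)
      ... | yes _ | no _   = trans (+-congˡ (sumList-filter-⊎ disj ps)) (sym (+-assoc _ _ _))
      ... | no _  | yes _  = trans (+-congˡ (sumList-filter-⊎ disj ps)) (x∙yz≈y∙xz _ _ _)
      ... | no ¬e | no ¬e′ = ⊥-elim ([ ¬e , ¬e′ ]′ p)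

    IsSum-∪ : ∀ {E F : Pred U 0ℓ} {a b} → (∀ {x} → E x → ¬ F x) →
              IsSum f E a → IsSum f F b → IsSum f (λ x → E x ⊎ F x) (a + b)
    IsSum-∪ {E} {F} {a} {b} disj (ubE , leastE) (ubF , leastF) = upper , least
      where
      upper : UpperBound (PartialSum f (λ x → E x ⊎ F x)) (a + b)
      upper s (xs , u , ps , e) =
        ≤-trans (≤-reflexive (trans (sym e) (sumList-filter-⊎ disj ps)))
          (+-mono-≤ (ubE _ (_ , Unique.filter⁺ E? u , All.all-filter E? xs , refl))
                    (ubF _ (_ , Unique.filter⁺ F? u , All.all-filter F? xs , refl)))
        where
        E? : ∀ x → Dec (E x)
        E? x = em
        F? : ∀ x → Dec (F x)
        F? x = em

      least : ∀ v → UpperBound (PartialSum f (λ x → E x ⊎ F x)) v → a + b ≤ v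
      -- The suprema are taken one at a time. For a fixed partial sum `y` over `F`, every partial
      -- sum over `E` is at most `v - y`, so `a ≤ v - y`. Hence every such `y` is at most `v - a`,
      -- and so is `b`.
      least v ub = ≤-trans (≤-reflexive (+-comm a b)) (x≤z-y⇒x+y≤z (leastF _ λ y yF →
        x+y≤z⇒x≤z-y (≤-trans (≤-reflexive (+-comm y a)) (x≤z-y⇒x+y≤z (leastE _ λ x xE →
          x+y≤z⇒x≤z-y (ub _ (joined xE yF)))))))
        where
        joined : ∀ {x y} → PartialSum f E x → PartialSum f F y →
                 PartialSum f (λ x → E x ⊎ F x) (x + y)
        joined (xs , u , ps , e) (ys , v , qs , e′) =
          xs ++ ys ,
          Unique.++⁺ u v (λ { (p , q) → disj (All.lookup ps p) (All.lookup qs q) }) ,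
          All.++⁺ (All.map inj₁ ps) (All.map inj₂ qs) , trans (sumList-++ xs ys) (+-cong e e′)

    IsSum-⋃ : ∀ {n} (E : Fin n → Pred U 0ℓ) (q : Fin n → Carrier) →
              (∀ {g h x} → E g x → E h x → g ≡ h) → (∀ g → IsSum f (E g) (q g)) →
              IsSum f (λ x → ∃ λ g → E g x) (sum q)
    IsSum-⋃ {zero}  E q disj sums = IsSum-∅ λ ()
    IsSum-⋃ {suc n} E q disj sums =
      IsSum-resp-⇔ (λ { (inj₁ e) → zero , e ; (inj₂ (g , e)) → suc g , e })
                   (λ { (zero , e) → inj₁ e ; (suc g , e) → inj₂ (g , e) }) refl
        (IsSum-∪ (λ { e₀ (g , e) → zero≢suc (disj e₀ e) }) (sums zero)
          (IsSum-⋃ (E ∘ suc) (q ∘ suc) (λ e e′ → suc-injective (disj e e′)) (sums ∘ suc)))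
      where
      zero≢suc : ∀ {g : Fin n} → zero ≢ suc g
      zero≢suc ()

  Pr-isSum : ∀ D E → IsSum (mass D) E (Pr D E)
  Pr-isSum D E = proj₂ (complete _ _ _)

  Pr-unique : ∀ D {E s} → IsSum (mass D) E s → Pr D E ≈ s
  Pr-unique D {E} = supremum-unique (Pr-isSum D E)

  Pr-nonneg : ∀ D E → 0# ≤ Pr D E
  Pr-nonneg D E = proj₁ (Pr-isSum D E) 0# ([] , [] , [] , refl)

  Pr≤1 : ∀ D E → Pr D E ≤ 1#
  Pr≤1 D E = proj₂ (Pr-isSum D E) 1# λ s p → proj₁ (totalMass D) s (PartialSum-mono _ p)

  -- A point outside `E` can be added to any list of points of `E`. The total stays at most 1, so
  -- `Pr D E` is at most 1 minus the mass of that point.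
  almost-sure⇒null : ∀ D {E} → Pr D E ≈ 1# → ∀ {x} → ¬ E x → mass D x ≈ 0#
  almost-sure⇒null D {E} sure {x} x∉E = antisym
    (+-cancelˡ-≤ 1# (≤-trans (x≤z-y⇒x+y≤z 1≤1-mass) (≤-reflexive (sym (+-identityʳ 1#)))))
    (nonneg D x)
    where
    1≤1-mass : 1# ≤ 1# - mass D x
    1≤1-mass = ≤-trans (≤-reflexive (sym sure)) (proj₂ (Pr-isSum D E) _ λ { s (xs , u , ps , e) →
      x+y≤z⇒x≤z-y (proj₁ (totalMass D) _
        ( x ∷ xs
        , All.tabulate (λ { z∈xs ≡.refl → x∉E (All.lookup ps z∈xs) }) ∷ u
        , All.universal (λ _ → _) (x ∷ xs)
        , trans (+-comm _ _) (+-congʳ e) )) })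

-- Empirical distributions depend only on the underlying set.

module EmpiricalDistributions (em : ExcludedMiddle 0ℓ) (R : CompleteOrderedField)
                              {U : Set} (U↔ℕ : U ↔ ℕ) where
  open CompleteOrderedField R
  open Suprema em R
  open Probability R U↔ℕ
  open Distribution
  open Sums em R U↔ℕ
  open DecMembership _≟_ using () renaming (_∈?_ to _∈ˡ?_)

  Pr-cong : ∀ {D D′} → (∀ x → mass D x ≈ mass D′ x) → ∀ E → Pr D E ≈ Pr D′ E
  Pr-cong {D} {D′} D≈D′ E =
    Pr-unique D (supremum-resp (transfer (sym ∘ D≈D′)) (transfer D≈D′) refl (Pr-isSum D′ E))
    where
    sumList-cong : ∀ {f g} → (∀ x → f x ≈ g x) → ∀ xs → sumList f xs ≈ sumList g xs
    sumList-cong f≈g []       = refl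
    sumList-cong f≈g (x ∷ xs) = +-cong (f≈g x) (sumList-cong f≈g xs)
    transfer : ∀ {f g} → (∀ x → f x ≈ g x) → ∀ {s} → PartialSum f E s → PartialSum g E s
    transfer f≈g (xs , u , ps , e) = xs , u , ps , trans (sym (sumList-cong f≈g xs)) e

  inverse-unique : ∀ {x y z} → x * y ≈ 1# → x * z ≈ 1# → y ≈ z
  inverse-unique {x} {y} {z} xy≈1 xz≈1 = trans (sym (*-identityʳ y)) (trans (*-congˡ (sym xz≈1))
    (trans (sym (*-assoc y x z)) (trans (*-congʳ (trans (*-comm y x) xy≈1)) (*-identityˡ z))))

  module _ (T T′ : FiniteNonEmptySet U)
           (T⊆T′ : ∀ {x} → x ∈ elements T → x ∈ elements T′)
           (T′⊆T : ∀ {x} → x ∈ elements T′ → x ∈ elements T) where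

    size-cong : size T ≡ size T′
    size-cong = ℕ.≤-antisym (unique-length (FiniteNonEmptySet.unique T) T⊆T′)
                            (unique-length (FiniteNonEmptySet.unique T′) T′⊆T)

    weight-cong : weight T ≈ weight T′
    weight-cong = inverse-unique (proj₂ (inverse (fromℕ (size T)) (size≉0 T)))
      (trans (*-congʳ (reflexive (≡.cong fromℕ size-cong)))
             (proj₂ (inverse (fromℕ (size T′)) (size≉0 T′))))

    -- Finite sets are represented by duplicate-free lists. This allows passing between a given
    -- representation `T` and the deduplicated input that presents `T`.
    emp-cong : ∀ E → Pr (emp T) E ≈ Pr (emp T′) E
    emp-cong = Pr-cong {emp T} {emp T′} uniformMass-cong
      where
      uniformMass-cong : ∀ x → uniformMass T x ≈ uniformMass T′ x
      uniformMass-cong x with x ∈ˡ? elements T | x ∈ˡ? elements T′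
      ... | yes _ | yes _ = weight-cong
      ... | yes p | no ¬q = contradiction (T⊆T′ p) ¬q
      ... | no ¬p | yes q = contradiction (T′⊆T q) ¬p
      ... | no _  | no _  = refl

-- Scarcity as the obstruction to fresh and representative distributions.

module Scarcity (em : ExcludedMiddle 0ℓ) (R : CompleteOrderedField) {U : Set} (U↔ℕ : U ↔ ℕ)
                (C : ℕ → Language U) {K : ℕ} (A : Partition U K)
                (α : CompleteOrderedField.Carrier R) where
  open CompleteOrderedField R
  open CommutativeRing commutativeRing using (+-commutativeSemigroup)
  open CommutativeSemigroupProperties +-commutativeSemigroup using (x∙yz≈y∙xz)
  open FieldLemmas R
  open OrderedFieldProperties R
  open Suprema em R
  open RepresentativeGeneration R U↔ℕ C A α
  open Partition A using (block; covers; disjoint)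
  open Distribution
  open Sums em R U↔ℕ

  -- The blocks are disjoint and cover `U`, so their probabilities add up to the total mass.
  sum-groupProb : ∀ D → sum (groupProb D) ≈ 1#
  sum-groupProb D = supremum-unique
    (IsSum-resp-⇔ _ (λ {x} _ → covers x) refl
      (IsSum-⋃ block (groupProb D) disjoint (λ g → Pr-isSum D (block g))))
    (totalMass D)

  -- Any prescribed group probabilities `q` are realised by a distribution with at most one atom per
  -- group, located at the chosen point of that group.
  module Atoms (point : Fin K → U) (point∈ : ∀ g → block g (point g))
               (q : Fin K → Carrier) (q-nonneg : ∀ g → 0# ≤ q g) (sum-q : sum q ≈ 1#) where

    group : U → Fin K
    group x = proj₁ (covers x)

    atomMass : U → Carrier
    atomMass x = if does (em {x ≡ point (group x)}) then q (group x) else 0#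

    atomMass-nonneg : ∀ x → 0# ≤ atomMass x
    atomMass-nonneg x with em {x ≡ point (group x)}
    ... | yes _ = q-nonneg (group x)
    ... | no  _ = ≤-refl

    atomMass-null : ∀ {g x} → block g x → x ≢ point g → atomMass x ≈ 0#
    atomMass-null {g} {x} x∈g x≢ with em {x ≡ point (group x)}
    ... | no  _  = refl
    ... | yes x≡ = contradiction
      (≡.trans x≡ (≡.cong point (disjoint (proj₂ (covers x)) x∈g))) x≢

    atomMass-point : ∀ g → atomMass (point g) ≡ q g
    atomMass-point g with group (point g) | disjoint (proj₂ (covers (point g))) (point∈ g)
    ... | _ | ≡.refl rewrite dec-true (em {point g ≡ point g}) ≡.refl = ≡.refl

    atomMass-block : ∀ g → IsSum atomMass (block g) (q g)
    atomMass-block g = IsSum-extend (λ { ≡.refl → point∈ g }) atomMass-null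
      (IsSum-resp-⇔ id id (reflexive (atomMass-point g)) (IsSum-singleton (atomMass-nonneg _)))

    atoms : Distribution
    atoms .mass      = atomMass
    atoms .nonneg    = atomMass-nonneg
    atoms .totalMass = IsSum-resp-⇔ _ (λ {x} _ → covers x) sum-q
      (IsSum-⋃ block q disjoint atomMass-block)

    groupProb-atoms : ∀ g → groupProb atoms g ≈ q g
    groupProb-atoms g = Pr-unique atoms (atomMass-block g)

  module _ (𝒟 : List ℕ) (T : FiniteNonEmptySet U) where

    Fresh : Pred U 0ℓ
    Fresh x = InAll 𝒟 x × x ∉ elements T

    FreshRepresentative : Distribution → Set
    FreshRepresentative D =
      (∀ g → abs (groupProb (emp T) g - groupProb D g) ≤ α) × Pr D Fresh ≈ 1#

    private
      e : Fin K → Carrier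
      e = groupProb (emp T)

    sumOver-e : ∀ B → sumOver B e + sumOver (∁ B) e ≈ 1#
    sumOver-e B = trans (sumOver-∁ B e) (sum-groupProb (emp T))

    -- Rewrites the bound in the scarcity condition as one `α` for each group outside `B`, the form
    -- in which `sumOver-const` yields it.
    α*fromℕ : ∀ B → α * fromℕ (K ℕ.∸ ∣ B ∣) ≈ ∣ ∁ B ∣ · α
    α*fromℕ B = trans (*-comm _ _) (trans (fromℕ-* (K ℕ.∸ ∣ B ∣) α)
      (reflexive (≡.cong (_· α) (≡.sym (∣∁p∣≡n∸∣p∣ B)))))

    freshRepresentative⇒¬scarce : ∀ {D} → FreshRepresentative D → ¬ GroupScarcity 𝒟 T
    freshRepresentative⇒¬scarce {D} (rep , sure) (B , B⇔ , scarce) =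
      [ largeGroup , largeSum ]′ scarce
      where
      p : Fin K → Carrier
      p = groupProb D

      -- An exhausted group contains no fresh point, and points that are not fresh have mass zero.
      exhausted-null : ∀ {g} → g ∈ˢ B → p g ≈ 0#
      exhausted-null {g} g∈B = Pr-unique D (IsSum-extend {E′ = λ _ → ⊥} (λ ())
        (λ {x} x∈g _ → almost-sure⇒null D sure (Equivalence.to (B⇔ g) g∈B x x∈g))
        (IsSum-∅ λ ()))

      largeGroup : ¬ (∃ λ g → g ∈ˢ B × α < e g)
      largeGroup (g , g∈B , α≤e , α≉e) = α≉e (antisym α≤e
        (≤-trans (∣x-y∣≤z⇒x≤z+y (rep g))
          (≤-reflexive (trans (+-congˡ (exhausted-null g∈B)) (+-identityʳ α)))))

      sum-B : sumOver B p ≤ 0#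
      sum-B = ≤-trans (sumOver-mono B {g = λ _ → 0#} (λ g g∈B → ≤-reflexive (exhausted-null g∈B)))
        (≤-reflexive (trans (sumOver-const B 0#) (trans (sym (fromℕ-* ∣ B ∣ 0#)) (zeroʳ _))))

      sum-∁B : sumOver (∁ B) p ≤ ∣ ∁ B ∣ · α + sumOver (∁ B) e
      sum-∁B = ≤-trans (sumOver-mono (∁ B) (λ g _ → ∣x-y∣≤z⇒y≤z+x (rep g)))
        (≤-reflexive (trans (sumOver-+ (∁ B) (λ _ → α) e) (+-congʳ (sumOver-const (∁ B) α))))

      -- Both distributions have total 1. The sum of `p` over `B` vanishes, and over the complement
      -- `p` exceeds `e` by at most `α` per group. Cancelling the sum of `e` over the complement
      -- bounds its sum over `B`.
      largeSum : ¬ (α * fromℕ (K ℕ.∸ ∣ B ∣) < sumOver B e)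
      largeSum (small , distinct) = distinct (antisym small
        (≤-trans (+-cancelʳ-≤ (sumOver (∁ B) e)
          (≤-trans (≤-reflexive (trans (sumOver-e B)
                     (trans (sym (sum-groupProb D)) (sym (sumOver-∁ B p)))))
          (≤-trans (+-mono-≤ sum-B sum-∁B) (≤-reflexive (+-identityˡ _)))))
          (≤-reflexive (sym (α*fromℕ B)))))

    module _ (0≤α : 0# ≤ α) (¬scarce : ¬ GroupScarcity 𝒟 T) where

      private
        B : Subset K
        B = Vec.tabulate (λ g → does (em {Exhausted 𝒟 T g}))

        B⇔ : ∀ g → g ∈ˢ B ⇔ Exhausted 𝒟 T g
        B⇔ g = mk⇔ (to ∘ ≡.trans (≡.sym lookup-B) ∘ []=⇒lookup)
                   (λ ex → lookup⇒[]= g B (≡.trans lookup-B (dec-true em ex)))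
          where
          lookup-B : Vec.lookup B g ≡ does (em {Exhausted 𝒟 T g})
          lookup-B = lookup∘tabulate _ g
          to : does (em {Exhausted 𝒟 T g}) ≡ true → Exhausted 𝒟 T g
          to eq with em {Exhausted 𝒟 T g}
          ... | yes ex = ex

        e-B≤α : ∀ {g} → g ∈ˢ B → e g ≤ α
        e-B≤α {g} g∈B = ¬<⇒≥ λ α<e → ¬scarce (B , B⇔ , inj₁ (g , g∈B , α<e))

        sum-B≤ : sumOver B e ≤ ∣ ∁ B ∣ · α
        sum-B≤ = ≤-trans (¬<⇒≥ λ lt → ¬scarce (B , B⇔ , inj₂ lt)) (≤-reflexive (α*fromℕ B))

        e-nonneg : ∀ g → 0# ≤ e g
        e-nonneg g = Pr-nonneg (emp T) (block g)

        0≤sum-B : 0# ≤ sumOver B e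
        0≤sum-B = ≤-trans (≤-trans (·-nonneg ∣ B ∣ ≤-refl) (≤-reflexive (sym (sumOver-const B 0#))))
          (sumOver-mono B (λ g _ → e-nonneg g))

        -- The location of the atom of each group: a fresh point if there is one. In an exhausted
        -- group any point of the nonempty block serves, because `q` assigns that group no mass.
        point : ∀ g → ∃ λ x → block g x × (g ∈ˢ ∁ B → Fresh x)
        point g with em {∃ λ x → block g x × Fresh x}
        ... | yes (x , x∈g , fresh) = x , x∈g , λ _ → fresh
        ... | no none with Partition.nonEmpty A g
        ...   | x , x∈g = x , x∈g , λ g∈∁B → contradiction
          (Equivalence.from (B⇔ g) λ y y∈g fresh → none (y , y∈g , fresh)) (x∈∁p⇒x∉p g∈∁B)

        -- The mass of the exhausted groups is shared equally among the others.
        excess : ∃ λ d → ∣ ∁ B ∣ · d ≈ sumOver B e × 0# ≤ d × d ≤ α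
        excess with ∣ ∁ B ∣ in eq
        -- If every group were exhausted, the absence of scarcity would bound the whole empirical
        -- mass by an empty multiple of `α`, although it equals 1.
        ... | zero = ⊥-elim (1≰0 (≤-trans (≤-reflexive (sym (sumOver-e B)))
          (≤-trans (+-mono-≤ sum-B≤0 sum-∁B≤0) (≤-reflexive (+-identityˡ 0#)))))
          where
          sum-B≤0 : sumOver B e ≤ 0#
          sum-B≤0 = ≤-trans sum-B≤ (≤-reflexive (reflexive (≡.cong (_· α) eq)))
          sum-∁B≤0 : sumOver (∁ B) e ≤ 0#
          sum-∁B≤0 = ≤-trans (sumOver-mono (∁ B) (λ g _ → Pr≤1 (emp T) (block g)))
            (≤-reflexive (trans (sumOver-const (∁ B) 1#) (reflexive (≡.cong (_· 1#) eq))))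
        ... | suc n with ·-divide n (sumOver B e)
        ...   | d , nd≈ = d , nd≈ , 0≤d , d≤α
          where
          0≤d : 0# ≤ d
          0≤d = ·-cancelˡ-≤ n (≤-trans (≤-reflexive (trans (sym (fromℕ-* (suc n) 0#)) (zeroʳ _)))
            (≤-trans 0≤sum-B (≤-reflexive (sym nd≈))))
          d≤α : d ≤ α
          d≤α = ·-cancelˡ-≤ n (≤-trans (≤-reflexive nd≈)
            (≤-trans sum-B≤ (≤-reflexive (reflexive (≡.cong (_· α) eq)))))

        d : Carrier
        d = proj₁ excess

        0≤d : 0# ≤ d
        0≤d = proj₁ (proj₂ (proj₂ excess))

        d≤α : d ≤ α
        d≤α = proj₂ (proj₂ (proj₂ excess))

        -- This is the summand in the definition of `sumOver (∁ B)`, so `sum q` unfolds to a sum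
        -- over the groups outside `B`.
        q : Fin K → Carrier
        q g = if Vec.lookup (∁ B) g then e g + d else 0#

        q-nonneg : ∀ g → 0# ≤ q g
        q-nonneg g with Vec.lookup (∁ B) g
        ... | true  = +-nonneg (e-nonneg g) 0≤d
        ... | false = ≤-refl

        sum-q : sum q ≈ 1#
        sum-q = trans (sumOver-+ (∁ B) e (λ _ → d)) (trans (+-comm _ _) (trans
          (+-congʳ (trans (sumOver-const (∁ B) d) (proj₁ (proj₂ excess)))) (sumOver-e B)))

        open Atoms (λ g → proj₁ (point g)) (λ g → proj₁ (proj₂ (point g))) q q-nonneg sum-q

        representative : ∀ g → abs (e g - groupProb atoms g) ≤ α
        representative g = ∣x-y∣≤z
          (≤-trans (proj₁ close) (+-mono-≤ ≤-refl (≤-reflexive (sym (groupProb-atoms g)))))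
          (≤-trans (≤-reflexive (groupProb-atoms g)) (proj₂ close))
          where
          close : e g ≤ α + q g × q g ≤ α + e g
          -- Outside `B` the deviation is `d`, which lies between 0 and `α`. Inside `B` all of `e g`
          -- is lost, and the absence of scarcity bounds it by `α`.
          close with Vec.lookup (∁ B) g in eq
          ... | true  = ≤-trans (x≤x+y (+-nonneg 0≤α 0≤d)) (≤-reflexive (x∙yz≈y∙xz _ _ _)) ,
                        ≤-trans (≤-reflexive (+-comm _ _)) (+-monoˡ-≤ (e g) d≤α)
          ... | false = ≤-trans (e-B≤α (∈B (g ∈? B))) (≤-reflexive (sym (+-identityʳ α))) ,
                        +-nonneg 0≤α (e-nonneg g)
            where
            ∈B : Dec (g ∈ˢ B) → g ∈ˢ B
            ∈B (yes g∈B) = g∈B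
            ∈B (no  g∉B) with ≡.trans (≡.sym eq) ([]=⇒lookup (x∉p⇒x∈∁p g∉B))
            ... | ()

        -- A point can carry mass only as the atom of a group outside `B`, and those atoms were
        -- chosen fresh.
        null : ∀ {x} → ¬ Fresh x → atomMass x ≈ 0#
        null {x} stale with em {x ≡ proj₁ (point (group x))}
        ... | no  _  = refl
        ... | yes x≡ with Vec.lookup (∁ B) (group x) in eq
        ...   | false = refl
        ...   | true  = contradiction
          (≡.subst Fresh (≡.sym x≡)
            (proj₂ (proj₂ (point (group x))) (lookup⇒[]= (group x) (∁ B) eq)))
          stale

      ¬scarce⇒freshRepresentative : ∃ FreshRepresentative
      ¬scarce⇒freshRepresentative =
        atoms , representative , Pr-unique atoms (IsSum-restrict _ (λ _ → null) (totalMass atoms))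

-- Least witnesses and bounds for lists of natural numbers.

least : ExcludedMiddle 0ℓ → (P : Pred ℕ 0ℓ) → ∀ {n} → P n → ∃ λ k → P k × (∀ j → P j → k ℕ.≤ j)
-- The search below `suc n` includes the known witness `n`, so it cannot come back empty.
least em P {n} Pn = [ id , (λ none → contradiction Pn (none n ℕ.≤-refl)) ]′ (search (suc n))
  where
  search : ∀ n → (∃ λ k → P k × (∀ j → P j → k ℕ.≤ j)) ⊎ (∀ j → j ℕ.< n → ¬ P j)
  search zero = inj₂ λ _ ()
  search (suc n) with search n | em {P n}
  ... | inj₁ found | _      = inj₁ found
  ... | inj₂ none  | yes Pn = inj₁ (n , Pn , λ j Pj → ℕ.≮⇒≥ λ j<n → none j j<n Pj)
  ... | inj₂ none  | no ¬Pn = inj₂ λ j j<1+n Pj →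
    [ (λ j<n → none j j<n Pj) , (λ { ≡.refl → ¬Pn Pj }) ]′ (ℕ.m<1+n⇒m<n∨m≡n j<1+n)

strictBound : (xs : List ℕ) → ∃ λ N → ∀ {j} → j ∈ xs → j ℕ.< N
strictBound []       = 0 , λ ()
strictBound (x ∷ xs) with strictBound xs
... | N , bound = suc x ℕ.⊔ N , λ
  { (here ≡.refl) → ℕ.m≤m⊔n (suc x) N
  ; (there j∈xs)  → ℕ.≤-trans (bound j∈xs) (ℕ.m≤n⊔m (suc x) N) }

-- Enumerations with a prescribed beginning.

module _ {U : Set} where

  prepend : List U → (ℕ → U) → ℕ → U
  prepend []       y t       = y t
  prepend (x ∷ xs) y zero    = x
  prepend (x ∷ xs) y (suc t) = prepend xs y t

  applyUpTo-prepend : ∀ xs y → applyUpTo (prepend xs y) (length xs) ≡ xs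
  applyUpTo-prepend []       y = ≡.refl
  applyUpTo-prepend (x ∷ xs) y = ≡.cong (x ∷_) (applyUpTo-prepend xs y)

  history-prepend : ∀ h y → history (prepend (toList h) y) (length (tail h)) ≡ h
  history-prepend (x ∷ xs) y = ≡.cong (x ∷_) (applyUpTo-prepend xs y)

  prepend-All : ∀ {P : Pred U 0ℓ} {xs y} → All P xs → (∀ t → P (y t)) → ∀ t → P (prepend xs y t)
  prepend-All []       Py t       = Py t
  prepend-All (p ∷ ps) Py zero    = p
  prepend-All (p ∷ ps) Py (suc t) = prepend-All ps Py t

  prepend-reaches : ∀ xs {y t} → ∃ λ t′ → prepend xs y t′ ≡ y t
  prepend-reaches []       {t = t} = t , ≡.refl
  prepend-reaches (x ∷ xs) with prepend-reaches xs
  ... | t′ , eq = suc t′ , eq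

  -- After the entries of `h`, run through all of `U` along the bijection and replace each string
  -- outside `L` by the first entry of `h`. Thus guarantees stated for enumerations apply to every
  -- finite input drawn from `L`.
  extend-enumeration : ExcludedMiddle 0ℓ → U ↔ ℕ → (L : Language U) (h : List⁺ U) →
                       All (L ∋_) (toList h) → ∃ λ x → Enumerates x L × ∃ λ t → history x t ≡ h
  extend-enumeration em U↔ℕ L h@(x₀ ∷ _) h⊆L@(x₀∈L ∷ _) =
    prepend (toList h) y ,
    record { sound    = prepend-All h⊆L y-sound
           ; complete = λ z z∈L → let t , eq = prepend-reaches (toList h) in
                                  t , ≡.trans eq (y-complete z z∈L) } ,
    length (tail h) , history-prepend h y
    where
    y : ℕ → U
    y t = if does (em {L ∋ Inverse.from U↔ℕ t}) then Inverse.from U↔ℕ t else x₀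

    y-sound : ∀ t → L ∋ y t
    y-sound t with em {L ∋ Inverse.from U↔ℕ t}
    ... | yes p = p
    ... | no  _ = x₀∈L

    y-complete : ∀ z → L ∋ z → y (Inverse.to U↔ℕ z) ≡ z
    y-complete z z∈L rewrite Inverse.strictlyInverseʳ U↔ℕ z | dec-true (em {L ∋ z}) z∈L = ≡.refl

  toList⁺ : (T : FiniteNonEmptySet U) → ∃ λ h → toList h ≡ elements T
  toList⁺ T with elements T | FiniteNonEmptySet.nonEmpty T
  ... | []     | ne = contradiction ≡.refl ne
  ... | x ∷ xs | _  = x ∷ xs , ≡.refl

-- Invariants of the Representative Procedure.

module Procedure (em : ExcludedMiddle 0ℓ) (R : CompleteOrderedField) {U : Set} (U↔ℕ : U ↔ ℕ)
                 (C : ℕ → Language U) {K : ℕ} (A : Partition U K)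
                 (α : CompleteOrderedField.Carrier R) where
  open RepresentativeGeneration R U↔ℕ C A α

  InAll-antimono : ∀ {𝒟 ℰ} → (∀ {j} → j ∈ ℰ → j ∈ 𝒟) → ∀ {x} → InAll 𝒟 x → InAll ℰ x
  InAll-antimono ℰ⊆𝒟 ps = All.tabulate (All.lookup ps ∘ ℰ⊆𝒟)

  -- `ScarceSize` asks for a sublist of `i ∷ ρ` in its order. Filtering `i ∷ ρ` by membership in `𝒟`
  -- gives one with the same members, and scarcity depends only on the members.
  scarceSize : ∀ {ρ i 𝒟 T} → (∀ {j} → j ∈ 𝒟 → j ∈ i ∷ ρ) → i ∈ 𝒟 →
               All (InAll 𝒟) (elements T) → GroupScarcity 𝒟 T → ScarceSize ρ i (size T)
  scarceSize {ρ} {i} {𝒟} {T} 𝒟⊆ i∈𝒟 T⊆ (B , B⇔ , large) =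
    T , ≡.refl , ℰ , filter-⊆ ∈𝒟? (i ∷ ρ) , 𝒟⊆ℰ i∈𝒟 , All.map (InAll-antimono ℰ⊆𝒟) T⊆ ,
    B , (λ g → mk⇔
      (λ g∈B x x∈g (all , x∉T) → Equivalence.to (B⇔ g) g∈B x x∈g (InAll-antimono 𝒟⊆ℰ all , x∉T))
      (λ ex → Equivalence.from (B⇔ g) λ x x∈g (all , x∉T) →
        ex x x∈g (InAll-antimono ℰ⊆𝒟 all , x∉T))) ,
    large
    where
    ∈𝒟? : ∀ j → Dec (j ∈ 𝒟)
    ∈𝒟? j = em
    ℰ : List ℕ
    ℰ = filter ∈𝒟? (i ∷ ρ)
    ℰ⊆𝒟 : ∀ {j} → j ∈ ℰ → j ∈ 𝒟
    ℰ⊆𝒟 = proj₂ ∘ ∈-filter⁻ ∈𝒟? {xs = i ∷ ρ}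
    𝒟⊆ℰ : ∀ {j} → j ∈ 𝒟 → j ∈ ℰ
    𝒟⊆ℰ j∈𝒟 = ∈-filter⁺ ∈𝒟? (𝒟⊆ j∈𝒟) j∈𝒟

  ScarceSize-mono : ∀ {ρ σ i n} → (∀ {j} → j ∈ ρ → j ∈ σ) → ScarceSize ρ i n → ScarceSize σ i n
  ScarceSize-mono ρ⊆σ (T , ≡.refl , 𝒟 , sub , i∈𝒟 , T⊆ , scarce) = scarceSize
    (λ j∈𝒟 → widen (lookup sub j∈𝒟)) i∈𝒟 T⊆ scarce
    where
    widen : ∀ {j} → j ∈ _ ∷ _ → j ∈ _ ∷ _
    widen (here eq)   = here eq
    widen (there j∈ρ) = there (ρ⊆σ j∈ρ)

  checkValue-bound : ∀ {ρ i c n} → CheckValue ρ i c → ScarceSize ρ i n → n ℕ.≤ c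
  checkValue-bound (inj₁ (_ , bound)) s = bound _ s
  checkValue-bound (inj₂ (none , _))  s = contradiction s (none _)

  module _ (m : ℕ → ℕ) where

    -- As orderings are stored last entry first, this says that `m` is nondecreasing in the order of
    -- the procedure.
    Sorted : List ℕ → Set
    Sorted = AllPairs (λ k l → m l ℕ.≤ m k)

    data Bounded : List ℕ → Set where
      []  : Bounded []
      _∷_ : ∀ {k ρ} → (∀ n → ScarceSize ρ k n → n ℕ.≤ m k) → Bounded ρ → Bounded (k ∷ ρ)

    -- The index found is the entry of `𝒟` placed last: once the head `k` of the list belongs to
    -- `𝒟`, all of `𝒟` lies among `k` and the entries before it, where the bound for `k` applies.
    bounded-scarcity : ∀ {ρ} → Bounded ρ → ∀ {𝒟 T i} → (∀ {j} → j ∈ 𝒟 → j ∈ ρ) → i ∈ 𝒟 →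
                       All (InAll 𝒟) (elements T) → GroupScarcity 𝒟 T →
                       ∃ λ k → k ∈ 𝒟 × size T ℕ.≤ m k
    bounded-scarcity [] 𝒟⊆ρ i∈𝒟 _ _ with 𝒟⊆ρ i∈𝒟
    ... | ()
    bounded-scarcity {k ∷ ρ} (bound ∷ bounds) {𝒟} 𝒟⊆ρ i∈𝒟 T⊆ scarce with em {k ∈ 𝒟}
    ... | yes k∈𝒟 = k , k∈𝒟 , bound _ (scarceSize 𝒟⊆ρ k∈𝒟 T⊆ scarce)
    ... | no  k∉𝒟 = bounded-scarcity bounds 𝒟⊆ρ′ i∈𝒟 T⊆ scarce
      where
      𝒟⊆ρ′ : ∀ {j} → j ∈ 𝒟 → j ∈ ρ
      𝒟⊆ρ′ j∈𝒟 with 𝒟⊆ρ j∈𝒟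
      ... | here ≡.refl = contradiction j∈𝒟 k∉𝒟
      ... | there j∈ρ   = j∈ρ

    insert-∈⁻ : ∀ {i ρ ρ′} → Insert m i ρ ρ′ → ∀ {j} → j ∈ ρ′ → j ∈ i ∷ ρ
    insert-∈⁻ (stop-first _) p         = p
    insert-∈⁻ (stop _ _)     p         = p
    insert-∈⁻ (swap _ _ ins) (here eq) = there (here eq)
    insert-∈⁻ (swap _ _ ins) (there p) with insert-∈⁻ ins p
    ... | here eq = here eq
    ... | there q = there (there q)

    insert-∈⁺ : ∀ {i ρ ρ′} → Insert m i ρ ρ′ → ∀ {j} → j ∈ i ∷ ρ → j ∈ ρ′
    insert-∈⁺ (stop-first _) p                 = p
    insert-∈⁺ (stop _ _)     p                 = p
    insert-∈⁺ (swap _ _ ins) (here eq)         = there (insert-∈⁺ ins (here eq))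
    insert-∈⁺ (swap _ _ ins) (there (here eq)) = here eq
    insert-∈⁺ (swap _ _ ins) (there (there p)) = there (insert-∈⁺ ins (there p))

    -- `σ` consists of the entries in front of `i` when the loop stops. The stopping test compares
    -- `m i` with its neighbour only, and sortedness extends the strict inequality to all of `σ`.
    insert-stops : ∀ {i ρ ρ′} → Insert m i ρ ρ′ → Sorted ρ →
                   ∃ λ σ → (∀ {j} → j ∈ σ → j ∈ ρ) × All (λ k → m k ℕ.< m i) σ ×
                           CheckValue σ i (m i)
    insert-stops (stop-first check) _ = [] , id , [] , check
    insert-stops (stop check lt) (below ∷ _) =
      _ , id , lt ∷ All.map (λ l≤k → ℕ.≤-<-trans l≤k lt) below , check
    insert-stops (swap _ _ ins) (_ ∷ sorted) with insert-stops ins sorted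
    ... | σ , σ⊆ρ , below , check = σ , there ∘ σ⊆ρ , below , check

    -- Each swap leaves fewer entries in front of `i`, so the final check ranges over fewer
    -- subcollections than an earlier one.
    swap-≤ : ∀ {i k ρ ρ′ c} → CheckValue (k ∷ ρ) i c → Sorted ρ → Insert m i ρ ρ′ → m i ℕ.≤ c
    swap-≤ check sorted ins with insert-stops ins sorted
    ... | σ , σ⊆ρ , _ , inj₁ (s , _)  = checkValue-bound check (ScarceSize-mono (there ∘ σ⊆ρ) s)
    ... | σ , _   , _ , inj₂ (_ , eq) = ℕ.≤-trans (ℕ.≤-reflexive eq) z≤n

    insert-sorted : ∀ {i ρ ρ′} → Insert m i ρ ρ′ → Sorted ρ → Sorted ρ′
    insert-sorted (stop-first _) _ = [] ∷ []
    insert-sorted (stop _ lt) (below ∷ sorted) =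
      (ℕ.<⇒≤ lt ∷ All.map (λ l≤k → ℕ.≤-trans l≤k (ℕ.<⇒≤ lt)) below) ∷ below ∷ sorted
    insert-sorted {i} (swap {k} {ρ} check c≤mk ins) (below ∷ sorted) =
      All.tabulate (λ j∈ρ′ → All.lookup below′ (insert-∈⁻ ins j∈ρ′)) ∷ insert-sorted ins sorted
      where
      below′ : All (λ l → m l ℕ.≤ m k) (i ∷ ρ)
      below′ = ℕ.≤-trans (swap-≤ check sorted ins) c≤mk ∷ below

    -- Entries that `i` does not pass keep the same entries in front of them. For an entry `k` that
    -- `i` passes, the only new subcollections contain `i`, and they were already covered by the
    -- check before the swap, whose value is at most `m k`.
    insert-bounded : ∀ {i ρ ρ′} → Insert m i ρ ρ′ → Bounded ρ → Bounded ρ′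
    insert-bounded (stop-first check) _ = (λ _ → checkValue-bound check) ∷ []
    insert-bounded (stop check _) bounds = (λ _ → checkValue-bound check) ∷ bounds
    insert-bounded {i} (swap {k} {ρ} {ρ′} check c≤mk ins) (bound ∷ bounds) =
      bound′ ∷ insert-bounded ins bounds
      where
      bound′ : ∀ n → ScarceSize ρ′ k n → n ℕ.≤ m k
      bound′ _ (T , ≡.refl , 𝒟 , sub , k∈𝒟 , T⊆ , scarce) with em {i ∈ 𝒟}
      ... | yes i∈𝒟 = ℕ.≤-trans
        (checkValue-bound check (scarceSize (widen ∘ lookup sub) i∈𝒟 T⊆ scarce)) c≤mk
        where
        widen : ∀ {j} → j ∈ k ∷ ρ′ → j ∈ i ∷ k ∷ ρ
        widen (here eq) = there (here eq)
        widen (there p) with insert-∈⁻ ins p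
        ... | here eq = here eq
        ... | there q = there (there q)
      ... | no i∉𝒟 = bound _ (scarceSize (λ j∈𝒟 → narrow j∈𝒟 (lookup sub j∈𝒟)) k∈𝒟 T⊆ scarce)
        where
        narrow : ∀ {j} → j ∈ 𝒟 → j ∈ k ∷ ρ′ → j ∈ k ∷ ρ
        narrow _   (here eq) = here eq
        narrow j∈𝒟 (there p) with insert-∈⁻ ins p
        ... | here ≡.refl = contradiction j∈𝒟 i∉𝒟
        ... | there q     = there q

    module _ (run : RepresentativeProcedure m) where
      open RepresentativeProcedure run

      ordering-sorted : ∀ i → Sorted (ordering i)
      ordering-sorted zero    = ≡.subst Sorted (≡.sym initial) []
      ordering-sorted (suc i) = insert-sorted (insert i) (ordering-sorted i)

      ordering-bounded : ∀ i → Bounded (ordering i)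
      ordering-bounded zero    = ≡.subst Bounded (≡.sym initial) []
      ordering-bounded (suc i) = insert-bounded (insert i) (ordering-bounded i)

      ordering-∈ : ∀ {j} i → j ℕ.< i → j ∈ ordering i
      ordering-∈ (suc i) j<1+i = insert-∈⁺ (insert i)
        ([ there ∘ ordering-∈ i , here ]′ (ℕ.m<1+n⇒m<n∨m≡n j<1+i))

      scarcity-bound : ∀ {𝒟 T i} → i ∈ 𝒟 → All (InAll 𝒟) (elements T) → GroupScarcity 𝒟 T →
                       ∃ λ k → k ∈ 𝒟 × size T ℕ.≤ m k
      scarcity-bound {𝒟} i∈𝒟 with strictBound 𝒟
      ... | N , bound = bounded-scarcity (ordering-bounded N) (λ j∈𝒟 → ordering-∈ N (bound j∈𝒟)) i∈𝒟

      -- The value 0 may be the default for an empty check. A nonzero value is the size of an actual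
      -- scarce set, found among the entries in front of `i` on stopping, all of strictly smaller
      -- `m`.
      scarcity-attained : ∀ i → m i ≢ 0 → ∃ λ T → size T ≡ m i × ∃ λ 𝒟 →
        (∀ {j} → j ∈ 𝒟 → j ≡ i ⊎ m j ℕ.< m i) × i ∈ 𝒟 ×
        All (InAll 𝒟) (elements T) × GroupScarcity 𝒟 T
      scarcity-attained i mi≢0 with insert-stops (insert i) (ordering-sorted i)
      ... | σ , _ , below , inj₂ (_ , mi≡0) = contradiction mi≡0 mi≢0
      ... | σ , _ , below , inj₁ ((T , size≡ , 𝒟 , sub , i∈𝒟 , T⊆ , scarce) , _) =
        T , size≡ , 𝒟 , split ∘ lookup sub , i∈𝒟 , T⊆ , scarce
        where
        split : ∀ {j} → j ∈ i ∷ σ → j ≡ i ⊎ m j ℕ.< m i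
        split (here eq) = inj₁ eq
        split (there p) = inj₂ (All.lookup below p)

-- The algorithm and the Pareto-optimality of its generation times.

module Optimality (em : ExcludedMiddle 0ℓ) (R : CompleteOrderedField) {U : Set} (U↔ℕ : U ↔ ℕ)
                  (C : ℕ → Language U) {K : ℕ} (A : Partition U K)
                  (α : CompleteOrderedField.Carrier R)
                  (0≤α : CompleteOrderedField._≤_ R (CompleteOrderedField.0# R) α) where
  open CompleteOrderedField R
  open OrderedFieldProperties R
  open RepresentativeGeneration R U↔ℕ C A α
  open Distribution
  open Sums em R U↔ℕ
  open EmpiricalDistributions em R U↔ℕ
  open Scarcity em R U↔ℕ C A α
  open Procedure em R U↔ℕ C A α
  open Partition A using (block)

  GenerationTime-mono : ∀ {G i k n} → k ℕ.≤ n → GenerationTime G i k → GenerationTime G i n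
  GenerationTime-mono k≤n (1≤k , fresh) =
    ℕ.≤-trans 1≤k k≤n , λ x enum t n≤ → fresh x enum t (ℕ.≤-trans k≤n n≤)

  -- The generator cannot tell the languages in 𝒟 apart after seeing exactly T.
  simultaneous⇒¬scarce : ∀ G → Generates G → ∀ {𝒟 T i} → i ∈ 𝒟 → All (InAll 𝒟) (elements T) →
                         (∀ {j} → j ∈ 𝒟 → GenerationTime G j (size T)) → ¬ GroupScarcity 𝒟 T
  simultaneous⇒¬scarce G (_ , _ , rep) {𝒟} {T} {i} i∈𝒟 T⊆ times =
    freshRepresentative⇒¬scarce 𝒟 T {G h} (representative , fresh)
    where
    h : List⁺ U
    h = proj₁ (toList⁺ T)

    h≡T : toList h ≡ elements T
    h≡T = proj₂ (toList⁺ T)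

    T⊆seen : ∀ {x} → x ∈ elements T → x ∈ elements (seen h)
    T⊆seen x∈T = ∈-deduplicate⁺ _≟_ (≡.subst (_ ∈_) (≡.sym h≡T) x∈T)

    seen⊆T : ∀ {x} → x ∈ elements (seen h) → x ∈ elements T
    seen⊆T x∈seen = ≡.subst (_ ∈_) h≡T (∈-deduplicate⁻ _≟_ (toList h) x∈seen)

    enumeration : ∀ {j} → j ∈ 𝒟 → ∃ λ x → Enumerates x (C j) × ∃ λ t → history x t ≡ h
    enumeration {j} j∈𝒟 = extend-enumeration em U↔ℕ (C j) h
      (≡.subst (All (C j ∋_)) (≡.sym h≡T) (All.map (λ all → All.lookup all j∈𝒟) T⊆))

    representative : ∀ g → abs (groupProb (emp T) g - groupProb (G h) g) ≤ α
    representative g = ∣x-y∣≤z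
      (≤-trans (≤-reflexive e≈) (∣x-y∣≤z⇒x≤z+y close))
      (≤-trans (∣x-y∣≤z⇒y≤z+x close) (≤-reflexive (+-congˡ (sym e≈))))
      where
      close : abs (groupProb (emp (seen h)) g - groupProb (G h) g) ≤ α
      close = let x , enum , t , eq = enumeration i∈𝒟
              in ≡.subst (RepresentativeAt G) eq (rep i x enum t) g
      e≈ : groupProb (emp T) g ≈ groupProb (emp (seen h)) g
      e≈ = emp-cong T (seen h) T⊆seen seen⊆T (block g)

    fresh-each : ∀ {j} → j ∈ 𝒟 → GeneratesFreshAt G j h
    fresh-each {j} j∈𝒟 = let x , enum , t , eq = enumeration j∈𝒟 in
      ≡.subst (GeneratesFreshAt G j) eq (proj₂ (times j∈𝒟) x enum t
      (≡.subst (λ h′ → size T ℕ.≤ size (seen h′)) (≡.sym eq)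
        (unique-length (FiniteNonEmptySet.unique T) T⊆seen)))

    -- The almost sure events for the members of `𝒟` are intersected pointwise: a point of nonzero
    -- mass belongs to each of them, hence is fresh for all of `𝒟`.
    null : ∀ {x} → ¬ Fresh 𝒟 T x → mass (G h) x ≈ 0#
    null {x} stale = decidable-stable em λ mass≉0 →
      let fresh-x : ∀ {j} → j ∈ 𝒟 → (C j ∋ x) × x ∉ elements (seen h)
          fresh-x j∈𝒟 = decidable-stable em (mass≉0 ∘ almost-sure⇒null (G h) (fresh-each j∈𝒟))
      in stale (All.tabulate (proj₁ ∘ fresh-x) , proj₂ (fresh-x i∈𝒟) ∘ T⊆seen)

    fresh : Pr (G h) (Fresh 𝒟 T) ≈ 1#
    fresh = Pr-unique (G h) (IsSum-restrict _ (λ _ → null) (totalMass (G h)))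

  module _ (m : ℕ → ℕ) (run : RepresentativeProcedure m)
           (finite : ∀ t → Finite (λ j → m j ℕ.+ 1 ℕ.≤ t)) where

    times : ℕ → ℕ
    times i = m i ℕ.+ 1

    Candidate : List⁺ U → Pred ℕ 0ℓ
    Candidate h j = times j ℕ.≤ size (seen h) × All (C j ∋_) (elements (seen h))

    candidate? : ∀ h j → Dec (Candidate h j)
    candidate? h j = em

    -- The list witnessing finiteness may contain other indices, and the filter removes them
    -- together with the languages that miss part of the input.
    candidates : List⁺ U → List ℕ
    candidates h = filter (candidate? h) (proj₁ (finite (size (seen h))))

    ∈-candidates⁻ : ∀ h {j} → j ∈ candidates h → Candidate h j
    ∈-candidates⁻ h = proj₂ ∘ ∈-filter⁻ (candidate? h) {xs = proj₁ (finite (size (seen h)))}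

    -- Scarcity would yield a candidate `k` with `size (seen h) ≤ m k`, whereas candidates satisfy
    -- `m k + 1 ≤ size (seen h)`.
    candidates-¬scarce : ∀ h {i} → i ∈ candidates h → ¬ GroupScarcity (candidates h) (seen h)
    candidates-¬scarce h i∈ scarce =
      let k , k∈ , size≤ = scarcity-bound m run i∈ consistent scarce
      in ℕ.<⇒≱ (≡.subst (ℕ._≤ size (seen h)) (ℕ.+-comm (m k) 1) (proj₁ (∈-candidates⁻ h k∈))) size≤
      where
      consistent : All (InAll (candidates h)) (elements (seen h))
      consistent = All.tabulate λ x∈ → All.tabulate λ j∈ →
        All.lookup (proj₂ (∈-candidates⁻ h j∈)) x∈

    -- Representation is due on every input, but freshness only where some language must be served,
    -- and there `candidates-¬scarce` rules scarcity out.
    Response : List⁺ U → Distribution → Set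
    Response h D =
      (∀ g → abs (groupProb (emp (seen h)) g - groupProb D g) ≤ α) ×
      (¬ GroupScarcity (candidates h) (seen h) → Pr D (Fresh (candidates h) (seen h)) ≈ 1#)

    respond : ∀ h → Dec (GroupScarcity (candidates h) (seen h)) → ∃ (Response h)
    -- The fallback copies the empirical distribution, which deviates from itself by zero.
    respond h (yes scarce) =
      emp (seen h) , (λ g → ∣x-y∣≤z x≤α+x x≤α+x) , λ ¬scarce → contradiction scarce ¬scarce
      where
      x≤α+x : ∀ {x} → x ≤ α + x
      x≤α+x {x} = ≤-trans (x≤x+y 0≤α) (≤-reflexive (+-comm x α))
    respond h (no ¬scarce) =
      let D , rep , fresh = ¬scarce⇒freshRepresentative (candidates h) (seen h) 0≤α ¬scarce
      in D , rep , λ _ → fresh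

    response : ∀ h → ∃ (Response h)
    response h = respond h em

    algorithm : Algorithm
    algorithm h = proj₁ (response h)

    algorithm-fresh : ∀ h {i} → i ∈ candidates h → GeneratesFreshAt algorithm i h
    algorithm-fresh h {i} i∈ = antisym (Pr≤1 (algorithm h) _)
      (≤-trans (≤-reflexive (sym (proj₂ (proj₂ (response h)) (candidates-¬scarce h i∈))))
        (proj₂ (Pr-isSum (algorithm h) _) _ λ s p → proj₁ (Pr-isSum (algorithm h) _) s
          (PartialSum-mono (λ (all , x∉) → All.lookup all i∈ , x∉) p)))

    ∈-candidates⁺ : ∀ {x i} → Enumerates x (C i) → ∀ t → times i ℕ.≤ size (seen (history x t)) →
                    i ∈ candidates (history x t)
    ∈-candidates⁺ {x} {i} enum t τ≤ = ∈-filter⁺ (candidate? h) (proj₂ (finite _) i τ≤)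
      (τ≤ , All.tabulate λ y∈ → All.lookup h⊆L (∈-deduplicate⁻ _≟_ (toList h) y∈))
      where
      h : List⁺ U
      h = history x t
      h⊆L : All (C i ∋_) (toList h)
      h⊆L = Enumerates.sound enum 0 ∷ All.applyUpTo⁺₂ _ t (Enumerates.sound enum ∘ suc)

    algorithm-generates : GeneratesWithTimes algorithm times
    algorithm-generates =
      (λ i → ℕ.m≤n+m 1 (m i) , λ x enum t τ≤ →
        algorithm-fresh (history x t) (∈-candidates⁺ enum t τ≤)) ,
      (λ i x enum t → proj₁ (proj₂ (response (history x t))))

    pareto-optimal : ParetoOptimal times
    pareto-optimal G gen@(_ , gen-times , _) i (n , (n-time , _) , n<τᵢ) =
      decidable-stable em λ none →
      let T , size≡ , 𝒟 , 𝒟-split , i∈𝒟 , T⊆ , scarce = scarcity-attained m run i mᵢ≢0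
          early : ∀ {j} → j ∈ 𝒟 → GenerationTime G j (size T)
          early j∈𝒟 = ≡.subst (GenerationTime G _) (≡.sym size≡) (timely none (𝒟-split j∈𝒟))
      in simultaneous⇒¬scarce G gen i∈𝒟 T⊆ early scarce
      where
      n≤mᵢ : n ℕ.≤ m i
      n≤mᵢ = ℕ.m<1+n⇒m≤n (≡.subst (n ℕ.<_) (ℕ.+-comm (m i) 1) n<τᵢ)

      mᵢ≢0 : m i ≢ 0
      -- Generation times are positive, so beating `m i + 1` forces `m i` to be at least 1, and a
      -- scarce set attaining it exists.
      mᵢ≢0 = ℕ.n>0⇒n≢0 (ℕ.≤-trans (proj₁ n-time) n≤mᵢ)

      -- If no other language is served later than `times`, then one with `m j < m i` is served by
      -- `m j + 1`, which is at most `m i`. For `i` itself the improved time `n` is at most `m i`.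
      timely : ¬ (∃ λ j → j ≢ i × (∃ λ k → LeastGenerationTime G j k × times j ℕ.< k)) →
               ∀ {j} → j ≡ i ⊎ m j ℕ.< m i → GenerationTime G j (m i)
      timely none (inj₁ ≡.refl) = GenerationTime-mono {G} n≤mᵢ n-time
      timely none {j} (inj₂ mⱼ<mᵢ) =
        let k , k-least@(k-time , _) = least em (GenerationTime G j) (gen-times j)
            k≤τⱼ : k ℕ.≤ times j
            k≤τⱼ = ℕ.≮⇒≥ λ τⱼ<k →
              none (j , (λ { ≡.refl → ℕ.<-irrefl ≡.refl mⱼ<mᵢ }) , k , k-least , τⱼ<k)
        in GenerationTime-mono {G}
             (ℕ.≤-trans k≤τⱼ (≡.subst (ℕ._≤ m i) (ℕ.+-comm 1 (m j)) mⱼ<mᵢ)) k-time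

mainTheorem9 : ExcludedMiddle 0ℓ →
    (ℝ : CompleteOrderedField) (let open CompleteOrderedField ℝ) →
    (U : Set) (U↔ℕ : U ↔ ℕ) →
    (C : ℕ → Language U) →
    (K : ℕ) (A : Partition U K) →
    (α : Carrier) → 0# ≤ α → α ≤ 1# →
    (let open RepresentativeGeneration ℝ U↔ℕ C A α) →
    (m⋆ : ℕ → ℕ) → RepresentativeProcedure m⋆ →
    (∀ t → Finite (λ j → m⋆ j ℕ.+ 1 ℕ.≤ t)) →
    ∃ λ (G : Algorithm) → ∃ λ (τ : ℕ → ℕ) → GeneratesWithTimes G τ × ParetoOptimal τ
mainTheorem9 em ℝ U U↔ℕ C K A α 0≤α _ m⋆ run finite =
  algorithm m⋆ run finite , times m⋆ run finite ,
  algorithm-generates m⋆ run finite , pareto-optimal m⋆ run finite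
  where open Optimality em ℝ U↔ℕ C A α 0≤α
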